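{- (a) There exist a connected graph $G$, a constant capacity function $L$ and an integer $k$ such that LP1 for $(G,L,k)$ is feasible but $G^4$ admits no hard-capacitated $k$-center solution (so the integrality gap of LP1 for connected graphs with uniform hard capacities is at least $5$). (b) There exist a connected graph $G$, a constant capacity function $L$ and $k$ such that soft LP1 for $(G,L,k)$ is feasible but $G^3$ admits no soft-capacitated $k$-center solution (gap at least $4$ for uniform soft capacities). (c) There exist a connected graph $G$, a capacity function $L$ all of whose nonzero values are equal, and $k$ such that LP1 for $(G,L,k)$ is feasible but $G^6$ admits no hard-capacitated $k$-center solution (gap at least $7$ for non-uniform hard capacities).
   Context: $G=(V,E)$ undirected unweighted, $\mathrm{dist}_G$ shortest-path distance, $L:V\to\mathbb{N}$, $k$ a positive integer. LP1: variables $x_{u,v},y_u$ with (1) $\sum_u y_u=k$; (2) $x_{u,v}\le y_u$; (3) $\sum_v x_{u,v}\le L(u)y_u$; (4) $\sum_u x_{u,v}=1$; (5) $0\le y_u\le1$; (6) $x_{u,v}=0$ if $\mathrm{dist}_G(u,v)>1$; (7) $x_{u,v}\ge0$. Soft LP1 is LP1 with the upper bound $y_u\le 1$ removed. $G^\delta$ is the graph on $V$ with $uv$ an edge iff $\mathrm{dist}_G(u,v)\le\delta$. A hard-capacitated $k$-center solution in a graph $H$ on $V$: a set $S\subseteq V$, $|S|\le k$, and $\phi:V\to S$ with $\phi(v)=v$ or $\phi(v)v\in E(H)$, and $|\phi^{ -1}(u)|\le L(u)$. A soft-capacitated $k$-center solution in $H$: $m:V\to\mathbb{Z}_{\ge0}$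 with $\sum m(u)\le k$ and $\phi:V\to V$ with $m(\phi(v))\ge1$, $\phi(v)=v$ or $\phi(v)v\in E(H)$, and $|\phi^{ -1}(u)|\le L(u)m(u)$. -}

module Defs where

open import Algebra.Properties.Monoid.Sum using (sum)
open import Data.Fin.Base using (Fin)
open import Data.Fin.Properties using (_≟_; any?)
open import Data.Fin.Subset using (Subset; _∈_; ∣_∣)
open import Data.Integer.Base using (+_)
open import Data.Nat.Base as ℕ using (ℕ; zero; suc; s≤s; s≤s⁻¹)
open import Data.Nat.Properties as ℕₚ using (anyUpTo?; allUpTo?)
open import Data.Product.Base using (∃; _×_; _,_)
open import Data.Rational.Base as ℚ using (ℚ; 0ℚ; 1ℚ; _/_)
open import Data.Rational.Properties as ℚₚ using ()
open import Data.Sum.Base using (_⊎_)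
open import Data.Vec.Base using (tabulate)
open import Relation.Binary.Definitions using (Decidable)
open import Relation.Binary.PropositionalEquality using (_≡_; _≢_; refl; sym)
open import Relation.Nullary.Decidable using (Dec; does; map′; _×-dec_; ¬?)
open import Relation.Nullary.Negation using (¬_)

sumℚ : ∀ {n} → (Fin n → ℚ) → ℚ
sumℚ = sum ℚₚ.+-0-monoid

sumℕ : ∀ {n} → (Fin n → ℕ) → ℕ
sumℕ = sum ℕₚ.+-0-monoid

fromℕ : ℕ → ℚ
fromℕ n = + n / 1

record Graph (n : ℕ) : Set₁ where
  field
    Adj        : Fin n → Fin n → Set
    adj?       : Decidable Adj
    adj-sym    : ∀ {u v} → Adj u v → Adj v u
    adj-irrefl : ∀ {u} → ¬ Adj u u

open Graph public

data Walk {n : ℕ} (G : Graph n) : Fin n → Fin n → ℕ → Set where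
  []  : ∀ {u} → Walk G u u 0
  _∷_ : ∀ {u w v d} → Adj G u w → Walk G w v d → Walk G u v (suc d)

Connected : ∀ {n} → Graph n → Set
Connected G = ∀ u v → ∃ λ d → Walk G u v d

-- The distance is a relation because it is infinite between different
-- components: `IsDist G u v d` says that dist_G(u,v) is the finite number d.
IsDist : ∀ {n} → Graph n → Fin n → Fin n → ℕ → Set
IsDist G u v d = Walk G u v d × (∀ {e} → e ℕ.< d → ¬ Walk G u v e)

DistAtMost : ∀ {n} → Graph n → ℕ → Fin n → Fin n → Set
DistAtMost G δ u v = ∃ λ d → d ℕ.≤ δ × IsDist G u v d

walk? : ∀ {n} (G : Graph n) u v d → Dec (Walk G u v d)
walk? G u v zero = map′ (λ { refl → [] }) (λ { [] → refl }) (u ≟ v)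
walk? G u v (suc d) =
  map′ (λ { (_ , a , p) → a ∷ p }) (λ { (a ∷ p) → _ , a , p })
       (any? λ w → adj? G u w ×-dec walk? G w v d)

isDist? : ∀ {n} (G : Graph n) u v d → Dec (IsDist G u v d)
isDist? G u v d =
  walk? G u v d ×-dec allUpTo? (λ e → ¬? (walk? G u v e)) d

distAtMost? : ∀ {n} (G : Graph n) δ → Decidable (DistAtMost G δ)
distAtMost? G δ u v =
  map′ (λ { (d , d<1+δ , p) → d , s≤s⁻¹ d<1+δ , p })
       (λ { (d , d≤δ , p) → d , s≤s d≤δ , p })
       (anyUpTo? (isDist? G u v) (suc δ))

snoc : ∀ {n} {G : Graph n} {u w v d} →
       Walk G u w d → Adj G w v → Walk G u v (suc d)
snoc []      a = a ∷ []
snoc (b ∷ p) a = b ∷ snoc p a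

reverse : ∀ {n} {G : Graph n} {u v d} → Walk G u v d → Walk G v u d
reverse         []      = []
reverse {G = G} (a ∷ p) = snoc (reverse p) (adj-sym G a)

distAtMost-sym : ∀ {n} (G : Graph n) {δ u v} →
                 DistAtMost G δ u v → DistAtMost G δ v u
distAtMost-sym G (d , d≤δ , p , shortest) =
  d , d≤δ , reverse p , λ e<d q → shortest e<d (reverse q)

-- Graphs here are simple, so a power has no loops even though dist(u,u) = 0.
_^_ : ∀ {n} → Graph n → ℕ → Graph n
G ^ δ = record
  { Adj        = λ u v → u ≢ v × DistAtMost G δ u v
  ; adj?       = λ u v → ¬? (u ≟ v) ×-dec distAtMost? G δ u v
  ; adj-sym    = λ { (u≢v , p) → (λ v≡u → u≢v (sym v≡u)) , distAtMost-sym G p }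
  ; adj-irrefl = λ { (u≢u , _) → u≢u refl }
  }

record Instance : Set₁ where
  field
    {n} : ℕ
    G   : Graph n
    L   : Fin n → ℕ
    k   : ℕ
    k>0 : k ℕ.> 0

record IsSoftLP1 (I : Instance)
                 (x : Fin (Instance.n I) → Fin (Instance.n I) → ℚ)
                 (y : Fin (Instance.n I) → ℚ) : Set where
  open Instance I
  field
    opening    : sumℚ y ≡ fromℕ k
    x≤y        : ∀ u v → x u v ℚ.≤ y u
    capacity   : ∀ u → sumℚ (λ v → x u v) ℚ.≤ fromℕ (L u) ℚ.* y u
    assignment : ∀ v → sumℚ (λ u → x u v) ≡ 1ℚ
    y≥0        : ∀ u → 0ℚ ℚ.≤ y u
    far        : ∀ u v → ¬ DistAtMost G 1 u v → x u v ≡ 0ℚ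
    x≥0        : ∀ u v → 0ℚ ℚ.≤ x u v

record IsLP1 (I : Instance)
             (x : Fin (Instance.n I) → Fin (Instance.n I) → ℚ)
             (y : Fin (Instance.n I) → ℚ) : Set where
  open Instance I
  field
    softLP1 : IsSoftLP1 I x y
    y≤1     : ∀ u → y u ℚ.≤ 1ℚ

-- Rational and real feasibility agree: all coefficients are integers.
LP1Feasible : Instance → Set
LP1Feasible I = ∃ λ x → ∃ λ y → IsLP1 I x y

SoftLP1Feasible : Instance → Set
SoftLP1Feasible I = ∃ λ x → ∃ λ y → IsSoftLP1 I x y

fibre : ∀ {n} → (Fin n → Fin n) → Fin n → Subset n
fibre φ u = tabulate λ v → does (φ v ≟ u)

record HardSolution (I : Instance) (H : Graph (Instance.n I)) : Set where
  open Instance I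
  field
    S        : Subset n
    ∣S∣≤k    : ∣ S ∣ ℕ.≤ k
    φ        : Fin n → Fin n
    φ∈S      : ∀ v → φ v ∈ S
    near     : ∀ v → φ v ≡ v ⊎ Adj H (φ v) v
    capacity : ∀ u → u ∈ S → ∣ fibre φ u ∣ ℕ.≤ L u

record SoftSolution (I : Instance) (H : Graph (Instance.n I)) : Set where
  open Instance I
  field
    m        : Fin n → ℕ
    Σm≤k     : sumℕ m ℕ.≤ k
    φ        : Fin n → Fin n
    open-φ   : ∀ v → 1 ℕ.≤ m (φ v)
    near     : ∀ v → φ v ≡ v ⊎ Adj H (φ v) v
    capacity : ∀ u → ∣ fibre φ u ∣ ℕ.≤ L u ℕ.* m u

ConnectedInstance : Instance → Set
ConnectedInstance I = Connected G
  where open Instance I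

Uniform : Instance → Set
Uniform I = ∃ λ c → ∀ u → L u ≡ c
  where open Instance I

NonzeroUniform : Instance → Set
NonzeroUniform I = ∀ u v → L u ≢ 0 → L v ≢ 0 → L u ≡ L v
  where open Instance I

HardSolvableIn SoftSolvableIn : ℕ → Instance → Set
HardSolvableIn δ I = HardSolution I (Instance.G I ^ δ)
SoftSolvableIn δ I = SoftSolution I (Instance.G I ^ δ)

-- The integrality gap over a class of instances is the least δ such that every
-- LP-feasible instance of the class has an integral solution in G^δ (infinite if
-- there is none).  Distances are integers, so δ may be taken integral.
GapAtLeast : (ρ : ℕ) (Class Feasible : Instance → Set)
             (SolvableIn : ℕ → Instance → Set) → Set₁
GapAtLeast ρ Class Feasible SolvableIn =
  ∀ δ → (∀ I → Class I → Feasible I → SolvableIn δ I) → ρ ℕ.≤ δ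

{-# OPTIONS --safe #-}
module Submission where

-- One tree-like graph serves all three parts.  A hub b is joined to six arms
-- b - d - c - a - T, where T is a clique of 23 leaves all adjacent to a; here
-- L = 15 and k = 11.  Fractionally, b and every a are opened once, and one leaf
-- of every arm is opened 2/3: b serves itself and the d's, a serves c and 7/12
-- of itself and of T, and the leaf serves the remaining 5/12.
--
-- Integrally, leaves of different arms are at distance 8, so that in G³ the
-- zones of the arms are disjoint, and in G⁴ (or in G⁶ when the c's and d's have
-- no capacity) they share only b.  If s i openings lie in arm i and b serves ℓ i
-- of its leaves then 23 ≤ 15 s i + ℓ i, hence 16 ≤ 8 s i + ℓ i.  With at most
-- one opening at b, μ ≤ 1, and Σ ℓ ≤ 15 μ, Σ s + μ ≤ 11, adding up gives
-- 96 ≤ 8 Σ s + 15 μ ≤ 88 + 7 μ ≤ 95.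

open import Defs
open import Data.Bool.Base using (Bool; true; false; if_then_else_)
open import Data.Empty using (⊥)
open import Data.Fin.Base using (Fin; zero; suc; toℕ; fromℕ<) renaming (fromℕ to maxFin)
open import Data.Fin.Properties
  using (_≟_; toℕ<n; toℕ-fromℕ; toℕ-fromℕ<; toℕ-inject₁; toℕ-injective)
open import Data.Fin.Subset using (Subset; _∈_; ∣_∣; inside; outside)
open import Data.Fin.Subset.Properties using (_∈?_; x∈p⇒∣p-x∣<∣p∣)
open import Data.Integer.Base as ℤ using (+_)
import Data.Integer.Properties as ℤₚ
import Data.Integer.Tactic.RingSolver as ℤSolver
open import Data.Nat.Base as ℕ
  using (ℕ; zero; suc; _+_; _*_; _≤_; _<_; _⊓_; z≤n; s≤s; s≤s⁻¹; _/_; _%_)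
import Data.Nat.Properties as ℕₚ
import Data.Nat.Tactic.RingSolver as ℕSolver
open import Data.Product.Base using (∃; _×_; _,_; proj₂)
open import Data.Rational.Base as ℚ using (ℚ; fromℚᵘ; 0ℚ; 1ℚ)
import Data.Rational.Properties as ℚₚ
open import Data.Rational.Unnormalised.Base as ℚᵘ using (mkℚᵘ; *≡*; *≤*)
import Data.Rational.Unnormalised.Properties as ℚᵘₚ
open import Data.Sum.Base as Sum using (_⊎_; inj₁; inj₂)
open import Data.Vec.Base using (_∷_; []; tabulate)
open import Data.Vec.Properties using (lookup∘tabulate; lookup⇒[]=)
open import Algebra.Properties.Semiring.Sum ℕₚ.+-*-semiring
  using (sum-cong-≗; sum-init-last; ∑-comm; ∑-distrib-+; *-distribˡ-sum; *-distribʳ-sum)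
open import Function.Base using (_∘_; case_of_)
open import Relation.Binary.PropositionalEquality
  using (_≡_; _≢_; refl; sym; trans; cong; cong₂; subst; subst₂; module ≡-Reasoning)
open import Relation.Nullary.Decidable
  using (Dec; yes; no; does; _×-dec_; _⊎-dec_; ¬?; toWitness; dec-true; dec-false)
open import Relation.Nullary.Negation using (¬_; contradiction)
open import Data.Unit.Base using (tt)

-- Finite sums of natural numbers

sum-mono-≤ : ∀ {n} {f g : Fin n → ℕ} → (∀ i → f i ≤ g i) → sumℕ f ≤ sumℕ g
sum-mono-≤ {zero}  f≤g = z≤n
sum-mono-≤ {suc n} f≤g = ℕₚ.+-mono-≤ (f≤g zero) (sum-mono-≤ (f≤g ∘ suc))

sum-zero : ∀ {n} {f : Fin n → ℕ} → (∀ i → f i ≡ 0) → sumℕ f ≡ 0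
sum-zero {zero}  f≡0 = refl
sum-zero {suc n} f≡0 = cong₂ _+_ (f≡0 zero) (sum-zero (f≡0 ∘ suc))

sum-*≤sum : ∀ {n} (f g : Fin n → ℕ) → (∀ i → g i ≤ 1) → sumℕ (λ i → f i * g i) ≤ sumℕ f
sum-*≤sum f g g≤1 = sum-mono-≤ λ i →
  ℕₚ.≤-trans (ℕₚ.*-monoʳ-≤ (f i) (g≤1 i)) (ℕₚ.≤-reflexive (ℕₚ.*-identityʳ (f i)))

-- Unlike sums over Fin, these are evaluated on binary literals.
sumBelow : ℕ → (ℕ → ℕ) → ℕ
sumBelow zero    f = 0
sumBelow (suc n) f = f n + sumBelow n f

sum∘toℕ : ∀ n (f : ℕ → ℕ) → sumℕ {n} (f ∘ toℕ) ≡ sumBelow n f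
sum∘toℕ zero    f = refl
sum∘toℕ (suc n) f =
  trans (sum-init-last {n} (f ∘ toℕ))
    (trans (ℕₚ.+-comm _ (f (toℕ (maxFin n))))
           (cong₂ _+_ (cong f (toℕ-fromℕ n))
                      (trans (sum-cong-≗ {n} (cong f ∘ toℕ-inject₁)) (sum∘toℕ n f))))

-- Indicators, cardinalities and fibres

𝟙 : ∀ {p} {P : Set p} → Dec P → ℕ
𝟙 P? = if does P? then 1 else 0

𝟙-yes : ∀ {p} {P : Set p} (P? : Dec P) → P → 𝟙 P? ≡ 1
𝟙-yes P? p rewrite dec-true P? p = refl

𝟙-no : ∀ {p} {P : Set p} (P? : Dec P) → ¬ P → 𝟙 P? ≡ 0
𝟙-no P? ¬p rewrite dec-false P? ¬p = refl

𝟙≤1 : ∀ {p} {P : Set p} (P? : Dec P) → 𝟙 P? ≤ 1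
𝟙≤1 P? with does P?
... | true  = ℕₚ.≤-refl
... | false = z≤n

𝟙-≤ : ∀ {p} {P : Set p} (P? : Dec P) {x y} → (P → 1 ≤ x + y) → 𝟙 P? ≤ x + 𝟙 P? * y
𝟙-≤ (no  _)         h = z≤n
𝟙-≤ (yes p) {x} {y} h = subst (λ z → 1 ≤ x + z) (sym (ℕₚ.*-identityˡ y)) (h p)

sum-indicator : ∀ {n} (g : Fin n → ℕ) w → sumℕ (λ u → g u * 𝟙 (w ≟ u)) ≡ g w
sum-indicator g zero = begin
  g zero * 1 + sumℕ (λ u → g (suc u) * 0)
    ≡⟨ cong₂ _+_ (ℕₚ.*-identityʳ (g zero)) (sum-zero (ℕₚ.*-zeroʳ ∘ g ∘ suc)) ⟩
  g zero + 0  ≡⟨ ℕₚ.+-identityʳ (g zero) ⟩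
  g zero      ∎
  where open ≡-Reasoning
sum-indicator g (suc w) =
  cong₂ _+_ (ℕₚ.*-zeroʳ (g zero)) (sum-indicator (g ∘ suc) w)

∣tabulate∣ : ∀ {n} (f : Fin n → Bool) →
             ∣ tabulate f ∣ ≡ sumℕ (λ i → if f i then 1 else 0)
∣tabulate∣ {zero}  f = refl
∣tabulate∣ {suc n} f with f zero
... | true  = cong suc (∣tabulate∣ (f ∘ suc))
... | false = ∣tabulate∣ (f ∘ suc)

∣p∣≡Σ𝟙 : ∀ {n} (p : Subset n) → ∣ p ∣ ≡ sumℕ (λ u → 𝟙 (u ∈? p))
∣p∣≡Σ𝟙 []            = refl
∣p∣≡Σ𝟙 (outside ∷ p) = ∣p∣≡Σ𝟙 p
∣p∣≡Σ𝟙 (inside  ∷ p) = cong suc (∣p∣≡Σ𝟙 p)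

fibre-empty : ∀ {n} (φ : Fin n → Fin n) u → (∀ v → φ v ≢ u) → ∣ fibre φ u ∣ ≡ 0
fibre-empty φ u φ≢u = trans (∣tabulate∣ (λ v → does (φ v ≟ u)))
  (sum-zero (λ v → 𝟙-no (φ v ≟ u) (φ≢u v)))

fibre-nonempty : ∀ {n} (φ : Fin n → Fin n) v → 1 ≤ ∣ fibre φ (φ v) ∣
fibre-nonempty φ v = ℕₚ.≤-trans (s≤s z≤n) (x∈p⇒∣p-x∣<∣p∣ v∈fibre)
  where
  v∈fibre : v ∈ fibre φ (φ v)
  v∈fibre = lookup⇒[]= v _ (trans (lookup∘tabulate (λ w → does (φ w ≟ φ v)) v)
                                  (dec-true (φ v ≟ φ v) refl))

-- Double counting: writing `g (φ v)` as a sum of indicators over all possible images allows the two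
-- sums to be exchanged.
sum-fibres : ∀ {n} (g : Fin n → ℕ) (φ : Fin n → Fin n) →
             sumℕ (λ v → g (φ v)) ≡ sumℕ (λ u → g u * ∣ fibre φ u ∣)
sum-fibres g φ = begin
  sumℕ (λ v → g (φ v))
    ≡⟨ sum-cong-≗ (λ v → sym (sum-indicator g (φ v))) ⟩
  sumℕ (λ v → sumℕ (λ u → g u * 𝟙 (φ v ≟ u)))
    ≡⟨ ∑-comm (λ v u → g u * 𝟙 (φ v ≟ u)) ⟩
  sumℕ (λ u → sumℕ (λ v → g u * 𝟙 (φ v ≟ u)))
    ≡⟨ sum-cong-≗ (λ u → sym (*-distribˡ-sum (g u) (λ v → 𝟙 (φ v ≟ u)))) ⟩
  sumℕ (λ u → g u * sumℕ (λ v → 𝟙 (φ v ≟ u)))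
    ≡⟨ sum-cong-≗ (λ u → cong (g u *_) (sym (∣tabulate∣ (λ v → does (φ v ≟ u))))) ⟩
  sumℕ (λ u → g u * ∣ fibre φ u ∣) ∎
  where open ≡-Reasoning

-- Linear programs over a common denominator

module _ (d : ℕ) where

  -- The denominator is `suc d`. Going through unnormalised fractions reduces the identities below
  -- to cross-multiplication, without gcds.
  frac : ℕ → ℚ
  frac a = fromℚᵘ (mkℚᵘ (+ a) d)

  frac-+ : ∀ a b → frac a ℚ.+ frac b ≡ frac (a + b)
  frac-+ a b = ℚₚ.toℚᵘ-injective (begin
    ℚ.toℚᵘ (frac a ℚ.+ frac b)
      ≈⟨ ℚₚ.toℚᵘ-homo-+ (frac a) (frac b) ⟩
    ℚ.toℚᵘ (frac a) ℚᵘ.+ ℚ.toℚᵘ (frac b)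
      ≈⟨ ℚᵘₚ.+-cong (ℚₚ.toℚᵘ-fromℚᵘ (mkℚᵘ (+ a) d)) (ℚₚ.toℚᵘ-fromℚᵘ (mkℚᵘ (+ b) d)) ⟩
    mkℚᵘ (+ a) d ℚᵘ.+ mkℚᵘ (+ b) d
      ≈⟨ *≡* (trans (identity (+ a) (+ b) (+ suc d))
                    (cong₂ ℤ._*_ (sym (ℤₚ.pos-+ a b)) (sym (ℤₚ.pos-* (suc d) (suc d))))) ⟩
    mkℚᵘ (+ (a + b)) d
      ≈⟨ ℚₚ.toℚᵘ-fromℚᵘ (mkℚᵘ (+ (a + b)) d) ⟨
    ℚ.toℚᵘ (frac (a + b)) ∎)
    where
    open import Relation.Binary.Reasoning.Setoid ℚᵘₚ.≃-setoid
    identity : ∀ x y z → (x ℤ.* z ℤ.+ y ℤ.* z) ℤ.* z ≡ (x ℤ.+ y) ℤ.* (z ℤ.* z)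
    identity = ℤSolver.solve-∀

  frac-* : ∀ l a → fromℕ l ℚ.* frac a ≡ frac (l * a)
  frac-* l a = ℚₚ.toℚᵘ-injective (begin
    ℚ.toℚᵘ (fromℕ l ℚ.* frac a)
      ≈⟨ ℚₚ.toℚᵘ-homo-* (fromℕ l) (frac a) ⟩
    ℚ.toℚᵘ (fromℕ l) ℚᵘ.* ℚ.toℚᵘ (frac a)
      ≈⟨ ℚᵘₚ.*-cong (ℚₚ.toℚᵘ-fromℚᵘ (mkℚᵘ (+ l) 0)) (ℚₚ.toℚᵘ-fromℚᵘ (mkℚᵘ (+ a) d)) ⟩
    mkℚᵘ (+ l) 0 ℚᵘ.* mkℚᵘ (+ a) d
      ≈⟨ *≡* (cong₂ ℤ._*_ (sym (ℤₚ.pos-* l a)) (cong +_ (sym (ℕₚ.*-identityˡ (suc d))))) ⟩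
    mkℚᵘ (+ (l * a)) d
      ≈⟨ ℚₚ.toℚᵘ-fromℚᵘ (mkℚᵘ (+ (l * a)) d) ⟨
    ℚ.toℚᵘ (frac (l * a)) ∎)
    where open import Relation.Binary.Reasoning.Setoid ℚᵘₚ.≃-setoid

  frac-integral : ∀ l → frac (l * suc d) ≡ fromℕ l
  frac-integral l = ℚₚ.fromℚᵘ-cong {mkℚᵘ (+ (l * suc d)) d} {mkℚᵘ (+ l) 0}
    (*≡* (trans (ℤₚ.*-identityʳ (+ (l * suc d))) (ℤₚ.pos-* l (suc d))))

  frac-mono : ∀ {a b} → a ≤ b → frac a ℚ.≤ frac b
  frac-mono {a} {b} a≤b = ℚₚ.toℚᵘ-cancel-≤
    (ℚᵘₚ.≤-respˡ-≃ (ℚᵘₚ.≃-sym (ℚₚ.toℚᵘ-fromℚᵘ (mkℚᵘ (+ a) d)))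
      (ℚᵘₚ.≤-respʳ-≃ (ℚᵘₚ.≃-sym (ℚₚ.toℚᵘ-fromℚᵘ (mkℚᵘ (+ b) d)))
        (*≤* (ℤₚ.*-monoʳ-≤-nonNeg (+ suc d) (ℤ.+≤+ a≤b)))))

  frac-zero : frac 0 ≡ 0ℚ
  frac-zero = frac-integral 0

  sum-frac : ∀ {n} (f : Fin n → ℕ) → sumℚ (λ i → frac (f i)) ≡ frac (sumℕ f)
  sum-frac {zero}  f = sym frac-zero
  sum-frac {suc n} f =
    trans (cong (frac (f zero) ℚ.+_) (sum-frac (f ∘ suc)))
          (frac-+ (f zero) (sumℕ (f ∘ suc)))

  module _ (I : Instance) where
    open Instance I

    -- With denominators cleared, every constraint concerns natural numbers only and can be checked
    -- by evaluation.
    scaled-LP1 : (P : Fin n → Fin n → ℕ) (Q : Fin n → ℕ) →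
                 sumℕ Q ≡ k * suc d →
                 (∀ u v → P u v ≤ Q u) →
                 (∀ u → sumℕ (P u) ≤ L u * Q u) →
                 (∀ v → sumℕ (λ u → P u v) ≡ suc d) →
                 (∀ u v → P u v ≡ 0 ⊎ u ≡ v ⊎ Adj G u v) →
                 (∀ u → Q u ≤ suc d) →
                 LP1Feasible I
    scaled-LP1 P Q ΣQ≡kd P≤Q cap assigned close Q≤d =
      (λ u v → frac (P u v)) , (λ u → frac (Q u)) , record
      { softLP1 = record
        { opening    = trans (sum-frac Q) (trans (cong frac ΣQ≡kd) (frac-integral k))
        ; x≤y        = λ u v → frac-mono (P≤Q u v)
        ; capacity   = λ u → subst₂ ℚ._≤_ (sym (sum-frac (P u)))
                                          (sym (frac-* (L u) (Q u)))
                                          (frac-mono (cap u))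
        ; assignment = λ v → trans (sum-frac (λ u → P u v))
                               (trans (cong frac (assigned v)) frac-one)
        ; y≥0        = λ u → 0≤frac (Q u)
        ; far        = far
        ; x≥0        = λ u v → 0≤frac (P u v)
        }
      ; y≤1 = λ u → subst (frac (Q u) ℚ.≤_) frac-one (frac-mono (Q≤d u))
      }
      where
      frac-one : frac (suc d) ≡ 1ℚ
      frac-one = trans (cong frac (sym (ℕₚ.*-identityˡ (suc d)))) (frac-integral 1)

      0≤frac : ∀ a → 0ℚ ℚ.≤ frac a
      0≤frac a = subst (ℚ._≤ frac a) frac-zero (frac-mono (z≤n {a}))

      far : ∀ u v → ¬ DistAtMost G 1 u v → frac (P u v) ≡ 0ℚ
      far u v ¬close with close u v
      ... | inj₁ P≡0        = trans (cong frac P≡0) frac-zero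
      ... | inj₂ (inj₁ refl) = contradiction (0 , z≤n , [] , λ ()) ¬close
      ... | inj₂ (inj₂ a)    = contradiction (1 , ℕₚ.≤-refl , a ∷ [] , λ {e} → shortest {e}) ¬close
        where
        shortest : ∀ {e} → e < 1 → ¬ Walk G u v e
        shortest (s≤s z≤n) [] = adj-irrefl G a

-- Arms of vertices glued together at the vertices of depth 0

-- Equal depths in one arm are linked, which later makes the leaves of an arm a clique. The carrier
-- is arbitrary so that the relation can be decided on `ℕ` and used on `Fin`.
Linked : ∀ {a} {A : Set a} (depth arm : A → ℕ) → A → A → Set
Linked depth arm u v =
  (depth u ≤ suc (depth v) × depth v ≤ suc (depth u))
  × (arm u ≡ arm v ⊎ depth u ≡ 0 ⊎ depth v ≡ 0)

linked? : ∀ {a} {A : Set a} (depth arm : A → ℕ) u v → Dec (Linked depth arm u v)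
linked? depth arm u v =
  (depth u ℕₚ.≤? suc (depth v) ×-dec depth v ℕₚ.≤? suc (depth u))
  ×-dec (arm u ℕₚ.≟ arm v ⊎-dec depth u ℕₚ.≟ 0 ⊎-dec depth v ℕₚ.≟ 0)

module Arms {n} (depth arm : Fin n → ℕ) where

  armGraph : Graph n
  armGraph = record
    { Adj        = λ u v → u ≢ v × Linked depth arm u v
    ; adj?       = λ u v → ¬? (u ≟ v) ×-dec linked? depth arm u v
    ; adj-sym    = λ { (u≢v , (p , q) , c) → u≢v ∘ sym , (q , p)
                     , Sum.map sym Sum.swap c }
    ; adj-irrefl = λ { (u≢u , _) → u≢u refl }
    }

  depth-lipschitz : ∀ {u v d} → Walk armGraph u v d → depth v ≤ depth u + d
  depth-lipschitz {u} [] = ℕₚ.m≤m+n (depth u) 0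
  depth-lipschitz {u} {v} (_∷_ {w = w} {d = d} (_ , (_ , w≤1+u) , _) p) = begin
    depth v            ≤⟨ depth-lipschitz p ⟩
    depth w + d        ≤⟨ ℕₚ.+-monoˡ-≤ d w≤1+u ⟩
    suc (depth u) + d  ≡⟨ sym (ℕₚ.+-suc (depth u) d) ⟩
    depth u + suc d    ∎
    where open ℕₚ.≤-Reasoning

  -- A walk that changes arm goes through depth 0.
  crossing : ∀ {u v d} → Walk armGraph u v d →
             arm u ≡ arm v ⊎ depth u + depth v ≤ d
  crossing [] = inj₁ refl
  crossing {u} {v} (_∷_ {w = w} {d = d} (_ , (u≤1+w , w≤1+u) , c) p)
    with crossing p | c
  ... | inj₂ w+v≤d | _ = inj₂ (ℕₚ.≤-trans (ℕₚ.+-monoˡ-≤ (depth v) u≤1+w) (s≤s w+v≤d))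
  ... | inj₁ w≡v | inj₁ u≡w = inj₁ (trans u≡w w≡v)
  -- A step that touches depth 0 may change arm, so what is known about arms is dropped; the depth
  -- bounds along the walk give the inequality directly.
  ... | inj₁ _ | inj₂ (inj₁ u≡0) = inj₂ (subst (λ x → x + depth v ≤ suc d) (sym u≡0)
          (ℕₚ.≤-trans (depth-lipschitz p)
                      (ℕₚ.+-monoˡ-≤ d (subst (λ x → depth w ≤ suc x) u≡0 w≤1+u))))
  ... | inj₁ _ | inj₂ (inj₂ w≡0) = inj₂
          (ℕₚ.+-mono-≤ (subst (λ x → depth u ≤ suc x) w≡0 u≤1+w)
                       (subst (λ x → depth v ≤ x + d) w≡0 (depth-lipschitz p)))

walk-++ : ∀ {n} {G : Graph n} {u v w d e} →
          Walk G u v d → Walk G v w e → Walk G u w (d + e)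
walk-++ []      q = q
walk-++ (a ∷ p) q = a ∷ walk-++ p q

connected-via : ∀ {n} (G : Graph n) (r : Fin n) (depth : Fin n → ℕ) →
                (∀ u → u ≡ r ⊎ ∃ λ w → Adj G u w × depth w < depth u) →
                Connected G
connected-via G r depth descend u v =
  _ , walk-++ (proj₂ (toRoot u (depth u) ℕₚ.≤-refl))
              (reverse (proj₂ (toRoot v (depth v) ℕₚ.≤-refl)))
  where
  -- The bound `b` on the depth is the structurally decreasing argument.
  toRoot : ∀ u b → depth u ≤ b → ∃ λ d → Walk G u r d
  toRoot u b u≤b with descend u
  toRoot u b u≤b       | inj₁ refl          = 0 , []
  toRoot u zero u≤0    | inj₂ (w , _ , w<u) = contradiction (ℕₚ.≤-trans w<u u≤0) λ ()
  toRoot u (suc b) u≤b | inj₂ (w , a , w<u) =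
    let d , p = toRoot w b (s≤s⁻¹ (ℕₚ.≤-trans w<u u≤b)) in suc d , a ∷ p

-- The counting argument for overloaded arms

module _ {n} (m : Fin n → ℕ) (φ : Fin n → Fin n)
         (load : ∀ u → ∣ fibre φ u ∣ ≤ 15 * m u) where

  -- For an indicator `g`: the vertices served from a set number at most 15 times the openings in
  -- it.
  sum-φ≤ : (g : Fin n → ℕ) → sumℕ (λ v → g (φ v)) ≤ 15 * sumℕ (λ u → g u * m u)
  sum-φ≤ g = begin
    sumℕ (λ v → g (φ v))              ≡⟨ sum-fibres g φ ⟩
    sumℕ (λ u → g u * ∣ fibre φ u ∣)  ≤⟨ sum-mono-≤ (λ u → ℕₚ.*-monoʳ-≤ (g u) (load u)) ⟩
    sumℕ (λ u → g u * (15 * m u))     ≡⟨ sum-cong-≗ (λ u → swap-15 (g u) (m u)) ⟩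
    sumℕ (λ u → 15 * (g u * m u))     ≡⟨ sym (*-distribˡ-sum 15 (λ u → g u * m u)) ⟩
    15 * sumℕ (λ u → g u * m u)       ∎
    where
    open ℕₚ.≤-Reasoning
    swap-15 : ∀ x y → x * (15 * y) ≡ 15 * (x * y)
    swap-15 = ℕSolver.solve-∀

  -- Sets enter as weights, so that disjointness is a pointwise bound on sums and every count is a
  -- sum that can be exchanged with another.
  arms-overloaded :
    (leaf inArm : Fin 6 → Fin n → ℕ) (hub : Fin n → ℕ) →
    sumℕ m ≤ 11 →
    (∀ i → 23 ≤ sumℕ (leaf i)) →
    (∀ v → sumℕ (λ i → leaf i v) ≤ 1) →
    (∀ u → sumℕ (λ i → inArm i u) + hub u ≤ 1) →
    (∀ i v → leaf i v ≤ inArm i (φ v) + leaf i v * hub (φ v)) →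
    sumℕ (λ u → hub u * m u) ≤ 1 →
    ⊥
  arms-overloaded leaf inArm hub Σm≤11 leaves disjointL disjointA served μ≤1 =
    contradiction (ℕₚ.≤-trans total (ℕₚ.≤-trans (budget (sumℕ s) μ Σs+μ≤11)
                                                (ℕₚ.+-monoʳ-≤ 88 (ℕₚ.*-monoʳ-≤ 7 μ≤1))))
                  (ℕₚ.<⇒≱ (ℕₚ.≤-refl {96}))
    where
    s ℓ : Fin 6 → ℕ
    s i = sumℕ (λ u → inArm i u * m u)
    ℓ i = sumℕ (λ v → leaf i v * hub (φ v))

    μ : ℕ
    μ = sumℕ (λ u → hub u * m u)

    demand : ∀ i → 23 ≤ 15 * s i + ℓ i
    demand i = begin
      23                                                     ≤⟨ leaves i ⟩
      sumℕ (leaf i)                                          ≤⟨ sum-mono-≤ (served i) ⟩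
      sumℕ (λ v → inArm i (φ v) + leaf i v * hub (φ v))      ≡⟨ ∑-distrib-+ (λ v → inArm i (φ v)) _ ⟩
      sumℕ (λ v → inArm i (φ v)) + ℓ i                       ≤⟨ ℕₚ.+-monoˡ-≤ (ℓ i) (sum-φ≤ (inArm i)) ⟩
      15 * s i + ℓ i                                         ∎
      where open ℕₚ.≤-Reasoning

    -- The integrality of x strengthens 23 ≤ 15x + y.
    rounded : ∀ x y → 23 ≤ 15 * x + y → 16 ≤ 8 * x + y
    rounded zero          y h = ℕₚ.≤-trans (ℕₚ.m≤m+n 16 7) h
    rounded (suc zero)    y h = ℕₚ.+-monoʳ-≤ 8 (ℕₚ.+-cancelˡ-≤ 15 8 y h)
    rounded (suc (suc x)) y h =
      ℕₚ.≤-trans (ℕₚ.*-monoʳ-≤ 8 (s≤s (s≤s (z≤n {x})))) (ℕₚ.m≤m+n (8 * suc (suc x)) y)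

    Σℓ≤15μ : sumℕ ℓ ≤ 15 * μ
    Σℓ≤15μ = begin
      sumℕ ℓ
        ≡⟨ ∑-comm (λ i v → leaf i v * hub (φ v)) ⟩
      sumℕ (λ v → sumℕ (λ i → leaf i v * hub (φ v)))
        ≡⟨ sum-cong-≗ (λ v → sym (*-distribʳ-sum (hub (φ v)) (λ i → leaf i v))) ⟩
      sumℕ (λ v → sumℕ (λ i → leaf i v) * hub (φ v))
        ≤⟨ sum-mono-≤ (λ v → ℕₚ.*-monoˡ-≤ (hub (φ v)) (disjointL v)) ⟩
      sumℕ (λ v → 1 * hub (φ v))
        ≡⟨ sum-cong-≗ (λ v → ℕₚ.*-identityˡ (hub (φ v))) ⟩
      sumℕ (λ v → hub (φ v))
        ≤⟨ sum-φ≤ hub ⟩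
      15 * μ ∎
      where open ℕₚ.≤-Reasoning

    Σs+μ≤11 : sumℕ s + μ ≤ 11
    Σs+μ≤11 = begin
      sumℕ s + μ
        ≡⟨ cong (_+ μ) (∑-comm (λ i u → inArm i u * m u)) ⟩
      sumℕ (λ u → sumℕ (λ i → inArm i u * m u)) + μ
        ≡⟨ cong (_+ μ) (sum-cong-≗ (λ u → sym (*-distribʳ-sum (m u) (λ i → inArm i u)))) ⟩
      sumℕ (λ u → sumℕ (λ i → inArm i u) * m u) + μ
        ≡⟨ sym (∑-distrib-+ (λ u → sumℕ (λ i → inArm i u) * m u) _) ⟩
      sumℕ (λ u → sumℕ (λ i → inArm i u) * m u + hub u * m u)
        ≡⟨ sum-cong-≗ (λ u → sym (ℕₚ.*-distribʳ-+ (m u) (sumℕ (λ i → inArm i u)) (hub u))) ⟩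
      sumℕ (λ u → (sumℕ (λ i → inArm i u) + hub u) * m u)
        ≤⟨ sum-mono-≤ (λ u → ℕₚ.*-monoˡ-≤ (m u) (disjointA u)) ⟩
      sumℕ (λ u → 1 * m u)
        ≡⟨ sum-cong-≗ (λ u → ℕₚ.*-identityˡ (m u)) ⟩
      sumℕ m
        ≤⟨ Σm≤11 ⟩
      11 ∎
      where open ℕₚ.≤-Reasoning

    total : 96 ≤ 8 * sumℕ s + 15 * μ
    total = begin
      -- 96 is 16 for each of the six arms.
      96                             ≤⟨ sum-mono-≤ {6} {λ _ → 16} (λ i → rounded (s i) (ℓ i) (demand i)) ⟩
      sumℕ (λ i → 8 * s i + ℓ i)     ≡⟨ ∑-distrib-+ (λ i → 8 * s i) ℓ ⟩
      sumℕ (λ i → 8 * s i) + sumℕ ℓ  ≡⟨ cong (_+ sumℕ ℓ) (sym (*-distribˡ-sum 8 s)) ⟩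
      8 * sumℕ s + sumℕ ℓ            ≤⟨ ℕₚ.+-monoʳ-≤ (8 * sumℕ s) Σℓ≤15μ ⟩
      8 * sumℕ s + 15 * μ            ∎
      where open ℕₚ.≤-Reasoning

    -- An opening in an arm is worth 8 and one at the hub 15: all eleven are priced at 8, and the
    -- hub adds the remaining 7.
    budget : ∀ x y → x + y ≤ 11 → 8 * x + 15 * y ≤ 88 + 7 * y
    budget x y x+y≤11 = begin
      8 * x + 15 * y       ≡⟨ regroup x y ⟩
      8 * (x + y) + 7 * y  ≤⟨ ℕₚ.+-monoˡ-≤ (7 * y) (ℕₚ.*-monoʳ-≤ 8 x+y≤11) ⟩
      88 + 7 * y           ∎
      where
      open ℕₚ.≤-Reasoning
      regroup : ∀ x y → 8 * x + 15 * y ≡ 8 * (x + y) + 7 * y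
      regroup = ℕSolver.solve-∀

-- The instance

-- Vertex 0 is the hub b; arm i consists of the vertices 1 + 26 i + j for j < 26,
-- where j = 0, 1, 2 are d, c, a and j = 3 is the leaf that is opened 2/3.
position : ℕ → ℕ
position zero    = 0
position (suc w) = suc (w % 26)

-- The hub gets the index 6, so that it lies in none of the arms 0 to 5.
arm : ℕ → ℕ
arm zero    = 6
arm (suc w) = w / 26

-- The cap puts all leaves of an arm at depth 4, hence makes them adjacent to each other and to a.
depth : ℕ → ℕ
depth u = position u ⊓ 4

-- 12 y as a function of the position.
opened : ℕ → ℕ
opened 0 = 12
opened 3 = 12
opened 4 = 8
opened _ = 0

-- 12 x as a function of the positions, for vertices in the same arm or b.
shipped : ℕ → ℕ → ℕ
shipped 0 0 = 12
shipped 0 1 = 12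
shipped 3 2 = 12
shipped 3 (suc (suc (suc _))) = 7
shipped 4 (suc (suc (suc _))) = 5
shipped _ _ = 0

inReach? : ∀ u v → Dec (arm u ≡ arm v ⊎ position u ≡ 0 ⊎ position v ≡ 0)
inReach? u v = arm u ℕₚ.≟ arm v ⊎-dec position u ℕₚ.≟ 0 ⊎-dec position v ℕₚ.≟ 0

P : ℕ → ℕ → ℕ
P u v = 𝟙 (inReach? u v) * shipped (position u) (position v)

Q : ℕ → ℕ
Q u = opened (position u)

hub : ℕ → ℕ
hub u = 𝟙 (depth u ℕₚ.≟ 0)

inArm : ℕ → ℕ → ℕ
inArm i u = 𝟙 (arm u ℕₚ.≟ i)

leaf? : ∀ i v → Dec (arm v ≡ i × depth v ≡ 4)
leaf? i v = arm v ℕₚ.≟ i ×-dec depth v ℕₚ.≟ 4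

leaf : ℕ → ℕ → ℕ
leaf i v = 𝟙 (leaf? i v)

-- The vertices d, c, a and the first leaf of an arm are consecutive; the other
-- leaves are sent back to a.
parent : ℕ → ℕ
parent zero    = 0
parent (suc w) = if w % 26 ℕ.≡ᵇ 0 then 0 else suc w ℕ.∸ (w % 26 ℕ.⊔ 3 ℕ.∸ 2)

Descends : ℕ → ℕ → Set
Descends u w = w < 157 × depth w < depth u × Linked depth arm u w

descends? : ∀ u w → Dec (Descends u w)
descends? u w = w ℕₚ.<? 157 ×-dec depth w ℕₚ.<? depth u ×-dec linked? depth arm u w

-- Abstract, so that the evaluated decision procedures are never unfolded.
abstract

  P≤Q : ∀ {u} → u < 157 → ∀ {v} → v < 157 → P u v ≤ Q u
  P≤Q = toWitness {a? = ℕₚ.allUpTo? (λ u → ℕₚ.allUpTo? (λ v → P u v ℕₚ.≤? Q u) 157) 157} tt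

  P-close : ∀ {u} → u < 157 → ∀ {v} → v < 157 → P u v ≡ 0 ⊎ u ≡ v ⊎ Linked depth arm u v
  P-close = toWitness {a? = ℕₚ.allUpTo? (λ u → ℕₚ.allUpTo? (λ v →
    P u v ℕₚ.≟ 0 ⊎-dec u ℕₚ.≟ v ⊎-dec linked? depth arm u v) 157) 157} tt

  Q≤12 : ∀ {u} → u < 157 → Q u ≤ 12
  Q≤12 = toWitness {a? = ℕₚ.allUpTo? (λ u → Q u ℕₚ.≤? 12) 157} tt

  -- This is 12 k: the hub contributes 12 and each of the six arms 12 + 8.
  sum-Q : sumBelow 157 Q ≡ 132
  sum-Q = refl

  -- Tight at a, where 12 + 24 * 7 = 15 * 12, and at the opened leaf, where 24 * 5 = 15 * 8.
  P-cap : ∀ {u} → u < 157 → sumBelow 157 (P u) ≤ 15 * Q u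
  P-cap = toWitness {a? = ℕₚ.allUpTo? (λ u → sumBelow 157 (P u) ℕₚ.≤? 15 * Q u) 157} tt

  P-assigned : ∀ {v} → v < 157 → sumBelow 157 (λ u → P u v) ≡ 12
  P-assigned = toWitness {a? = ℕₚ.allUpTo? (λ v → sumBelow 157 (λ u → P u v) ℕₚ.≟ 12) 157} tt

  leaves : ∀ {i} → i < 6 → 23 ≤ sumBelow 157 (leaf i)
  leaves = toWitness {a? = ℕₚ.allUpTo? (λ i → 23 ℕₚ.≤? sumBelow 157 (leaf i)) 6} tt

  leaf-disjoint : ∀ {v} → v < 157 → sumBelow 6 (λ i → leaf i v) ≤ 1
  leaf-disjoint = toWitness {a? = ℕₚ.allUpTo? (λ v → sumBelow 6 (λ i → leaf i v) ℕₚ.≤? 1) 157} tt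

  arm-disjoint : ∀ {u} → u < 157 → sumBelow 6 (λ i → inArm i u) + hub u ≤ 1
  arm-disjoint = toWitness
    {a? = ℕₚ.allUpTo? (λ u → sumBelow 6 (λ i → inArm i u) + hub u ℕₚ.≤? 1) 157} tt

  one-hub : sumBelow 157 hub ≡ 1
  one-hub = refl

  parent-descends : ∀ {u} → u < 157 → u ≡ 0 ⊎ Descends u (parent u)
  parent-descends = toWitness
    {a? = ℕₚ.allUpTo? (λ u → u ℕₚ.≟ 0 ⊎-dec descends? u (parent u)) 157} tt

-- Connectivity and fractional feasibility

open Arms {157} (depth ∘ toℕ) (arm ∘ toℕ)

armGraph-connected : Connected armGraph
armGraph-connected = connected-via armGraph zero (depth ∘ toℕ) descend
  where
  descend : ∀ u → u ≡ zero ⊎ ∃ λ w → Adj armGraph u w × depth (toℕ w) < depth (toℕ u)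
  descend u with parent-descends (toℕ<n u)
  ... | inj₁ u≡0 = inj₁ (toℕ-injective u≡0)
  ... | inj₂ (p<157 , deeper , linked) =
    inj₂ (w , (u≢w , subst (Linked depth arm (toℕ u)) (sym w≡p) linked) , w<u)
    where
    w : Fin 157
    w = fromℕ< p<157
    w≡p : toℕ w ≡ parent (toℕ u)
    w≡p = toℕ-fromℕ< p<157
    w<u : depth (toℕ w) < depth (toℕ u)
    w<u = subst (λ x → depth x < depth (toℕ u)) (sym w≡p) deeper
    u≢w : u ≢ w
    u≢w u≡w = ℕₚ.<⇒≢ w<u (cong (depth ∘ toℕ) (sym u≡w))

instanceWith : (Fin 157 → ℕ) → Instance
instanceWith L = record { G = armGraph ; L = L ; k = 11 ; k>0 = s≤s z≤n }

-- The hypothesis constrains `L` only where `Q` is nonzero, so the capacities of the c's and d's may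
-- vanish.
feasible : ∀ L → (∀ u → 15 * Q (toℕ u) ≤ L u * Q (toℕ u)) → LP1Feasible (instanceWith L)
-- The first argument 11 is the common denominator 12 less one, not `k`.
feasible L cap = scaled-LP1 11 (instanceWith L) (λ u v → P (toℕ u) (toℕ v)) (Q ∘ toℕ)
  (trans (sum∘toℕ 157 Q) sum-Q)
  (λ u v → P≤Q {toℕ u} (toℕ<n u) {toℕ v} (toℕ<n v))
  (λ u → ℕₚ.≤-trans (subst (_≤ 15 * Q (toℕ u)) (sym (sum∘toℕ 157 (P (toℕ u))))
                           (P-cap {toℕ u} (toℕ<n u)))
                    (cap u))
  (λ v → trans (sum∘toℕ 157 (λ u → P u (toℕ v))) (P-assigned {toℕ v} (toℕ<n v)))
  close
  (λ u → Q≤12 {toℕ u} (toℕ<n u))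
  where
  close : ∀ u v → P (toℕ u) (toℕ v) ≡ 0 ⊎ u ≡ v ⊎ Adj armGraph u v
  close u v with u ≟ v | P-close {toℕ u} (toℕ<n u) {toℕ v} (toℕ<n v)
  ... | yes u≡v | _ = inj₂ (inj₁ u≡v)
  ... | no  u≢v | inj₁ P≡0 = inj₁ P≡0
  ... | no  u≢v | inj₂ (inj₁ u≡v) = contradiction (toℕ-injective u≡v) u≢v
  ... | no  u≢v | inj₂ (inj₂ linked) = inj₂ (inj₂ (u≢v , linked))

-- Absence of integral solutions

near-arm : ∀ {δ u v} → u ≡ v ⊎ Adj (armGraph ^ δ) u v →
           arm (toℕ u) ≡ arm (toℕ v) ⊎ depth (toℕ u) + depth (toℕ v) ≤ δ
near-arm (inj₁ u≡v) = inj₁ (cong (arm ∘ toℕ) u≡v)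
near-arm (inj₂ (_ , _ , d≤δ , walk , _)) = Sum.map₂ (λ h → ℕₚ.≤-trans h d≤δ) (crossing walk)

-- The weight e singles out the hub where an arm may be served from there, and
-- is 0 where it may not.
overloaded : (m : Fin 157 → ℕ) (φ : Fin 157 → Fin 157) (e : Fin 157 → ℕ) →
             (∀ u → ∣ fibre φ u ∣ ≤ 15 * m u) →
             sumℕ m ≤ 11 →
             (∀ u → e u ≤ hub (toℕ u)) →
             sumℕ (λ u → e u * m u) ≤ 1 →
             (∀ v → depth (toℕ v) ≡ 4 → arm (toℕ (φ v)) ≡ arm (toℕ v) ⊎ e (φ v) ≡ 1) →
             ⊥
overloaded m φ e load Σm≤11 e≤hub Σe≤1 served = arms-overloaded m φ load
  (λ i v → leaf (toℕ i) (toℕ v)) (λ i u → inArm (toℕ i) (toℕ u)) e Σm≤11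
  (λ i → subst (23 ≤_) (sym (sum∘toℕ 157 (leaf (toℕ i)))) (leaves {toℕ i} (toℕ<n i)))
  (λ v → subst (_≤ 1) (sym (sum∘toℕ 6 (λ i → leaf i (toℕ v)))) (leaf-disjoint {toℕ v} (toℕ<n v)))
  (λ u → ℕₚ.≤-trans (ℕₚ.+-mono-≤ (ℕₚ.≤-reflexive (sum∘toℕ 6 (λ i → inArm i (toℕ u)))) (e≤hub u))
                    (arm-disjoint {toℕ u} (toℕ<n u)))
  leaf-served
  Σe≤1
  where
  leaf-served : ∀ i v → leaf (toℕ i) (toℕ v)
                ≤ inArm (toℕ i) (toℕ (φ v)) + leaf (toℕ i) (toℕ v) * e (φ v)
  leaf-served i v = 𝟙-≤ (leaf? (toℕ i) (toℕ v)) λ { (v∈i , v≡4) → case served v v≡4 of λ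
    { (inj₁ φv∈) → ℕₚ.≤-trans
        (ℕₚ.≤-reflexive (sym (𝟙-yes (arm (toℕ (φ v)) ℕₚ.≟ toℕ i) (trans φv∈ v∈i))))
        (ℕₚ.m≤m+n _ (e (φ v)))
    ; (inj₂ e≡1) → ℕₚ.≤-trans (ℕₚ.≤-reflexive (sym e≡1))
        (ℕₚ.m≤n+m _ (inArm (toℕ i) (toℕ (φ v))))
    } }

-- The last hypothesis says that the hub is the only vertex with capacity that could serve leaves of
-- a foreign arm. For δ = 4 depth alone ensures this; for δ = 6 the zero capacities are needed.
no-hard-solution : ∀ δ (L : Fin 157 → ℕ) → (∀ u → L u ≤ 15) →
                   (∀ u → 1 ≤ L u → depth (toℕ u) + 4 ≤ δ → depth (toℕ u) ≡ 0) →
                   ¬ HardSolvableIn δ (instanceWith L)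
no-hard-solution δ L L≤15 only-hub sol =
  overloaded m φ (hub ∘ toℕ) load
    (subst (_≤ 11) (∣p∣≡Σ𝟙 S) ∣S∣≤k) (λ _ → ℕₚ.≤-refl) hub≤1 served
  where
  open HardSolution sol

  m : Fin 157 → ℕ
  m u = 𝟙 (u ∈? S)

  load : ∀ u → ∣ fibre φ u ∣ ≤ 15 * m u
  load u = bound (u ∈? S)
    where
    bound : (u∈S? : Dec (u ∈ S)) → ∣ fibre φ u ∣ ≤ 15 * 𝟙 u∈S?
    bound (yes u∈S) = ℕₚ.≤-trans (capacity u u∈S) (L≤15 u)
    bound (no  u∉S) = ℕₚ.≤-reflexive
      (fibre-empty φ u λ v φv≡u → u∉S (subst (_∈ S) φv≡u (φ∈S v)))

  hub≤1 : sumℕ (λ u → hub (toℕ u) * m u) ≤ 1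
  hub≤1 = ℕₚ.≤-trans (sum-*≤sum (hub ∘ toℕ) m (λ u → 𝟙≤1 (u ∈? S)))
                     (ℕₚ.≤-reflexive (trans (sum∘toℕ 157 hub) one-hub))

  -- A vertex that serves another has capacity, which lets `only-hub` exclude the c's and d's.
  1≤L : ∀ v → 1 ≤ L (φ v)
  1≤L v = ℕₚ.≤-trans (fibre-nonempty φ v) (capacity (φ v) (φ∈S v))

  served : ∀ v → depth (toℕ v) ≡ 4 → arm (toℕ (φ v)) ≡ arm (toℕ v) ⊎ hub (toℕ (φ v)) ≡ 1
  served v v≡4 = Sum.map₂
    (λ h → 𝟙-yes (depth (toℕ (φ v)) ℕₚ.≟ 0)
             (only-hub (φ v) (1≤L v) (subst (λ x → depth (toℕ (φ v)) + x ≤ δ) v≡4 h)))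
    (near-arm (near v))

-- The multiplicity at the hub is not bounded by 1 here, but the hub is at distance 4 from every
-- leaf and serves none within 3; so its weight is taken to be 0.
no-soft-solution : ¬ SoftSolvableIn 3 (instanceWith (λ _ → 15))
no-soft-solution sol =
  overloaded m φ (λ _ → 0) capacity Σm≤k (λ _ → z≤n)
    (subst (_≤ 1) (sym (sum-zero {157} {λ u → 0 * m u} (λ _ → refl))) z≤n) served
  where
  open SoftSolution sol

  served : ∀ v → depth (toℕ v) ≡ 4 → arm (toℕ (φ v)) ≡ arm (toℕ v) ⊎ 0 ≡ 1
  served v v≡4 with near-arm (near v)
  ... | inj₁ same = inj₁ same
  ... | inj₂ h    = contradiction
    (ℕₚ.≤-trans (ℕₚ.m≤n+m 4 (depth (toℕ (φ v)))) (subst (λ x → depth (toℕ (φ v)) + x ≤ 3) v≡4 h))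
    (ℕₚ.<⇒≱ (ℕₚ.≤-refl {4}))

-- Non-uniform capacities, by depth

capacityAt : ℕ → ℕ
capacityAt 1 = 0
capacityAt 2 = 0
capacityAt _ = 15

capacityAt≤15 : ∀ d → capacityAt d ≤ 15
capacityAt≤15 0                   = ℕₚ.≤-refl
capacityAt≤15 1                   = z≤n
capacityAt≤15 2                   = z≤n
capacityAt≤15 (suc (suc (suc _))) = ℕₚ.≤-refl

capacityAt-nonzero : ∀ d → capacityAt d ≢ 0 → capacityAt d ≡ 15
capacityAt-nonzero 0                   _  = refl
capacityAt-nonzero 1                   ≢0 = contradiction refl ≢0
capacityAt-nonzero 2                   ≢0 = contradiction refl ≢0
capacityAt-nonzero (suc (suc (suc _))) _  = refl

capacityAt-opened : ∀ p → 15 * opened p ≤ capacityAt (p ⊓ 4) * opened p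
capacityAt-opened 0                   = ℕₚ.≤-refl
capacityAt-opened 1                   = z≤n
capacityAt-opened 2                   = z≤n
capacityAt-opened (suc (suc (suc _))) = ℕₚ.≤-refl

-- Depths 1 and 2 have no capacity, and from depth 3 on the sum is at least 7.
capacityAt-shallow : ∀ d → 1 ≤ capacityAt d → d + 4 ≤ 6 → d ≡ 0
capacityAt-shallow 0                   _ _ = refl
capacityAt-shallow (suc (suc (suc d))) _ h =
  contradiction (ℕₚ.≤-trans (ℕₚ.m≤n+m 4 d) (s≤s⁻¹ (s≤s⁻¹ (s≤s⁻¹ h)))) (ℕₚ.<⇒≱ (ℕₚ.≤-refl {4}))

-- Integrality gaps

distAtMost-mono : ∀ {n} (G : Graph n) {δ ε u v} → δ ≤ ε → DistAtMost G δ u v → DistAtMost G ε u v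
distAtMost-mono G δ≤ε (d , d≤δ , p) = d , ℕₚ.≤-trans d≤δ δ≤ε , p

hardSolvable-mono : ∀ {δ ε} I → δ ≤ ε → HardSolvableIn δ I → HardSolvableIn ε I
hardSolvable-mono I δ≤ε sol = record
  { S = S ; ∣S∣≤k = ∣S∣≤k ; φ = φ ; φ∈S = φ∈S ; capacity = capacity
  ; near = λ v → Sum.map₂ (λ { (≢ , p) → ≢ , distAtMost-mono (Instance.G I) δ≤ε p }) (near v)
  }
  where open HardSolution sol

softSolvable-mono : ∀ {δ ε} I → δ ≤ ε → SoftSolvableIn δ I → SoftSolvableIn ε I
softSolvable-mono I δ≤ε sol = record
  { m = m ; Σm≤k = Σm≤k ; φ = φ ; open-φ = open-φ ; capacity = capacity
  ; near = λ v → Sum.map₂ (λ { (≢ , p) → ≢ , distAtMost-mono (Instance.G I) δ≤ε p }) (near v)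
  }
  where open SoftSolution sol

-- If some δ ≤ r sufficed for the class, the given instance would be solvable at δ and, by
-- monotonicity, at r.
gapAtLeast : ∀ r (Class Feasible : Instance → Set) (SolvableIn : ℕ → Instance → Set) →
             (∀ {δ ε} I → δ ≤ ε → SolvableIn δ I → SolvableIn ε I) →
             ∀ I → Class I → Feasible I → ¬ SolvableIn r I →
             GapAtLeast (suc r) Class Feasible SolvableIn
gapAtLeast r Class Feasible SolvableIn mono I class feas unsolvable δ solvable with suc r ℕₚ.≤? δ
... | yes r<δ = r<δ
... | no  r≮δ =
  contradiction (mono I (s≤s⁻¹ (ℕₚ.≰⇒> r≮δ)) (solvable I class feas)) unsolvable

theorem6 : ( (∃ λ I → ConnectedInstance I × Uniform I × LP1Feasible I
    × ¬ HardSolvableIn 4 I)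
    × GapAtLeast 5 (λ I → ConnectedInstance I × Uniform I)
    LP1Feasible HardSolvableIn )
    × ( (∃ λ I → ConnectedInstance I × Uniform I × SoftLP1Feasible I
    × ¬ SoftSolvableIn 3 I)
    × GapAtLeast 4 (λ I → ConnectedInstance I × Uniform I)
    SoftLP1Feasible SoftSolvableIn )
    × ( (∃ λ I → ConnectedInstance I × NonzeroUniform I × LP1Feasible I
    × ¬ HardSolvableIn 6 I)
    × GapAtLeast 7 ConnectedInstance LP1Feasible HardSolvableIn )
theorem6 =
  ( (I , connected , uniform , hardFeasible , noHard)
  , gapAtLeast 4 (λ I → ConnectedInstance I × Uniform I) LP1Feasible HardSolvableIn
      hardSolvable-mono I (connected , uniform) hardFeasible noHard )
  , ( (I , connected , uniform , softFeasible , no-soft-solution)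
    , gapAtLeast 3 (λ I → ConnectedInstance I × Uniform I) SoftLP1Feasible SoftSolvableIn
        softSolvable-mono I (connected , uniform) softFeasible no-soft-solution )
  , ( (J , connected , uniformJ , feasibleJ , noHardJ)
    , gapAtLeast 6 ConnectedInstance LP1Feasible HardSolvableIn
        hardSolvable-mono J connected feasibleJ noHardJ )
  where
  I J : Instance
  I = instanceWith (λ _ → 15)
  J = instanceWith (λ u → capacityAt (depth (toℕ u)))

  connected : Connected armGraph
  connected = armGraph-connected

  uniform : Uniform I
  uniform = 15 , λ _ → refl

  hardFeasible : LP1Feasible I
  hardFeasible = feasible (λ _ → 15) (λ _ → ℕₚ.≤-refl)

  softFeasible : SoftLP1Feasible I
  softFeasible = let x , y , lp = hardFeasible in x , y , IsLP1.softLP1 lp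

  noHard : ¬ HardSolvableIn 4 I
  noHard = no-hard-solution 4 (λ _ → 15) (λ _ → ℕₚ.≤-refl)
    -- Here `h` reads depth + 4 ≤ 4, which leaves only depth 0.
    (λ u _ h → ℕₚ.n≤0⇒n≡0 (ℕₚ.+-cancelʳ-≤ 4 (depth (toℕ u)) 0 h))

  uniformJ : NonzeroUniform J
  uniformJ u v u≢0 v≢0 = trans (capacityAt-nonzero (depth (toℕ u)) u≢0)
                           (sym (capacityAt-nonzero (depth (toℕ v)) v≢0))

  feasibleJ : LP1Feasible J
  feasibleJ = feasible (λ u → capacityAt (depth (toℕ u)))
    (λ u → capacityAt-opened (position (toℕ u)))

  noHardJ : ¬ HardSolvableIn 6 J
  noHardJ = no-hard-solution 6 (λ u → capacityAt (depth (toℕ u)))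
    (λ u → capacityAt≤15 (depth (toℕ u)))
    (λ u → capacityAt-shallow (depth (toℕ u)))
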